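{- Let $p$ be an odd prime, let $A, B$ be integers, and let $\Delta = A^2 + 4B$. If $\Delta$ is a quadratic nonresidue modulo $p$, then $k_{A,B}(p)$ divides $2(p+1)\cdot \mathrm{ord}(B^2)$, where $\mathrm{ord}(n)$ denotes the multiplicative order of $n$ modulo $p$. In particular, $$k_{A,B}(p) \le 2(p+1)\cdot \mathrm{ord}(B^2).$$
   Context: For integers $A, B$, let $(E_n)_{n \ge 0}$ be the sequence defined by $E_0 = 0$, $E_1 = 1$ and $E_{n+1} = A E_n + B E_{n-1}$ for $n \ge 1$. For a prime $p$, $k_{A,B}(p)$ denotes the period of the sequence $(E_n)$ reduced modulo $p$, i.e. the smallest positive index $i$ such that $E_i \equiv 0$ and $E_{i+1} \equiv 1 \pmod p$ (this exists whenever $p \nmid B$, which is automatic when $\Delta$ is a quadratic nonresidue modulo $p$). The multiplicative order $\mathrm{ord}(n)$ of an integer $n$ coprime to $p$ is the smallest positive integer $t$ such that $n^t \equiv 1 \pmod p$. -}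

module Defs where

open import Data.Nat.Base as ℕ using (ℕ; zero; suc; z≤n; s≤s)
import Data.Nat.Properties as ℕ
import Data.Nat.Divisibility as ℕ
open import Data.Nat.Primality using (Prime; prime⇒nonZero; prime⇒irreducible; euclidsLemma)
open import Data.Integer.Base using (ℤ; +_; -_; _+_; _*_; _-_; _^_; ∣_∣; 0ℤ; 1ℤ)
open import Data.Integer.Properties using (abs-*; *-identityʳ)
open import Data.Integer.Coprimality using (Coprime; coprime-divisor)
open import Data.Integer.Divisibility.Signed
open import Data.Integer.DivMod using (_%ℕ_; _/ℕ_; n%ℕd<d; a≡a%ℕn+[a/ℕn]*n)
open import Data.Integer.Tactic.RingSolver using (solve-∀)
open import Data.Fin.Base using (Fin; toℕ; fromℕ<; combine)
open import Data.Fin.Properties using (pigeonhole; fromℕ<-injective; combine-injective)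
open import Data.Product.Base using (∃; ∃-syntax; _×_; _,_; proj₁; proj₂)
open import Data.Sum.Base using (_⊎_; inj₁; inj₂; [_,_]′)
open import Data.Empty using (⊥-elim)
open import Function.Base using (_∘_; id)
open import Level using (0ℓ)
open import Relation.Nullary using (¬_; Dec; yes; no)
open import Relation.Nullary.Decidable using (_×-dec_)
open import Relation.Unary using (Pred; Decidable)
open import Relation.Binary.PropositionalEquality using (_≡_; refl; sym; trans; cong; cong₂; subst; module ≡-Reasoning)

infix 4 _≡_[mod_] _≡?_[mod_]

_≡_[mod_] : ℤ → ℤ → ℕ → Set
a ≡ b [mod m ] = + m ∣ a - b

QuadraticNonresidue : ℕ → ℤ → Set
QuadraticNonresidue p a = ¬ (+ p ∣ a) × ¬ (∃[ x ] x ^ 2 ≡ a [mod p ])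

E : ℤ → ℤ → ℕ → ℤ
E A B zero          = 0ℤ
E A B (suc zero)    = 1ℤ
E A B (suc (suc n)) = A * E A B (suc n) + B * E A B n

IsLeastPositive : Pred ℕ 0ℓ → Pred ℕ 0ℓ
IsLeastPositive P n = 1 ℕ.≤ n × P n × (∀ j → 1 ℕ.≤ j → P j → n ℕ.≤ j)

IsOrder : ℕ → ℤ → Pred ℕ 0ℓ
IsOrder m n = IsLeastPositive λ t → n ^ t ≡ 1ℤ [mod m ]

IsPeriod : ℕ → ℤ → ℤ → Pred ℕ 0ℓ
IsPeriod m A B = IsLeastPositive λ i →
  E A B i ≡ 0ℤ [mod m ] × E A B (suc i) ≡ 1ℤ [mod m ]

-- ord and period are defined as functions, by proving that the least positive
-- numbers they denote exist.

least-positive : {P : Pred ℕ 0ℓ} → Decidable P →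
                 (∃[ n ] 1 ℕ.≤ n × P n) → ∃ (IsLeastPositive P)
least-positive {P} P? (n , 1≤n , Pn) =
  [ id , (λ none → ⊥-elim (none n ℕ.≤-refl 1≤n Pn)) ]′ (search n)
  where
  search : ∀ b → ∃ (IsLeastPositive P) ⊎ (∀ j → j ℕ.≤ b → 1 ℕ.≤ j → ¬ P j)
  search zero = inj₂ λ { zero _ () ; (suc _) () }
  search (suc b) with search b
  ... | inj₁ found = inj₁ found
  ... | inj₂ none with P? (suc b)
  ...   | yes Pb = inj₁ (suc b , s≤s z≤n , Pb , λ j 1≤j Pj →
                     ℕ.≰⇒> λ j≤b → none j j≤b 1≤j Pj)
  ...   | no ¬Pb = inj₂ λ j j≤1+b 1≤j Pj →
                     [ (λ j<1+b → none j (ℕ.≤-pred j<1+b) 1≤j Pj)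
                     , (λ { refl → ¬Pb Pj }) ]′ (ℕ.m≤n⇒m<n∨m≡n j≤1+b)

_≡?_[mod_] : ∀ a b m → Dec (a ≡ b [mod m ])
a ≡? b [mod m ] = + m ∣? a - b

private
  ∤⇒coprime : ∀ {p} → Prime p → ∀ n → ¬ (+ p ∣ n) → Coprime (+ p) n
  ∤⇒coprime pr n p∤n (d∣p , d∣n) with prime⇒irreducible pr d∣p
  ... | inj₁ d≡1 = d≡1
  ... | inj₂ refl = ⊥-elim (p∤n (∣ᵤ⇒∣ d∣n))

  cancel : ∀ m n x y → Coprime (+ m) n → n * x ≡ n * y [mod m ] → x ≡ y [mod m ]
  cancel m n x y c h = ∣ᵤ⇒∣ (coprime-divisor (+ m) n (x - y) c
    (∣⇒∣ᵤ (subst (+ m ∣_) (factor n x y) h)))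
    where
    factor : ∀ n x y → n * x - n * y ≡ n * (x - y)
    factor = solve-∀

  module Residue (m : ℕ) .{{_ : ℕ.NonZero m}} where

    residue : ℤ → Fin m
    residue a = fromℕ< (n%ℕd<d a m)

    residue-≡ : ∀ a b → residue a ≡ residue b → a ≡ b [mod m ]
    residue-≡ a b eq = divides (a /ℕ m - b /ℕ m) (begin
      a - b
        ≡⟨ cong₂ _-_ (a≡a%ℕn+[a/ℕn]*n a m) (a≡a%ℕn+[a/ℕn]*n b m) ⟩
      (+ (a %ℕ m) + a /ℕ m * + m) - (+ (b %ℕ m) + b /ℕ m * + m)
        ≡⟨ cong (λ r → (+ r + a /ℕ m * + m) - (+ (b %ℕ m) + b /ℕ m * + m))
             (fromℕ<-injective _ _ _ _ eq) ⟩
      (+ (b %ℕ m) + a /ℕ m * + m) - (+ (b %ℕ m) + b /ℕ m * + m)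
        ≡⟨ collect (+ (b %ℕ m)) (a /ℕ m) (b /ℕ m) (+ m) ⟩
      (a /ℕ m - b /ℕ m) * + m ∎)
      where
      open ≡-Reasoning
      collect : ∀ r x y m → (r + x * m) - (r + y * m) ≡ (x - y) * m
      collect = solve-∀

  collision : ∀ {m} (f : ℕ → Fin m) → ∃[ i ] ∃[ d ] 1 ℕ.≤ d × f (i ℕ.+ d) ≡ f i
  collision {m} f with pigeonhole (ℕ.n<1+n m) (f ∘ toℕ)
  ... | i , j , i<j , fi≡fj = toℕ i , toℕ j ℕ.∸ toℕ i , ℕ.m<n⇒0<n∸m i<j ,
    trans (cong f (ℕ.m+[n∸m]≡n (ℕ.<⇒≤ i<j))) (sym fi≡fj)

  pow-return : ∀ m n → Coprime (+ m) n → ∀ i d →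
               n ^ (i ℕ.+ d) ≡ n ^ i [mod m ] → n ^ d ≡ 1ℤ [mod m ]
  pow-return m n c zero    d h = h
  pow-return m n c (suc i) d h =
    pow-return m n c i d (cancel m n (n ^ (i ℕ.+ d)) (n ^ i) c h)

  E-return : ∀ m A B → Coprime (+ m) B → ∀ i d →
             E A B (i ℕ.+ d) ≡ E A B i [mod m ] →
             E A B (suc i ℕ.+ d) ≡ E A B (suc i) [mod m ] →
             E A B d ≡ 0ℤ [mod m ] × E A B (suc d) ≡ 1ℤ [mod m ]
  E-return m A B c zero    d h₀ h₁ = h₀ , h₁
  E-return m A B c (suc i) d h₁ h₂ = E-return m A B c i d
    (cancel m B (e (i ℕ.+ d)) (e i) c
      (subst (+ m ∣_)
        (step A B (e (suc (i ℕ.+ d))) (e (suc i)) (e (i ℕ.+ d)) (e i))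
        (∣m∣n⇒∣m-n h₂ (∣n⇒∣m*n A h₁))))
    h₁
    where
    e = E A B
    step : ∀ A B u v x y →
           ((A * u + B * x) - (A * v + B * y)) - A * (u - v) ≡ B * x - B * y
    step = solve-∀

ord-exists : ∀ m .{{_ : ℕ.NonZero m}} n → Coprime (+ m) n → ∃ (IsOrder m n)
ord-exists m n c = least-positive (λ t → n ^ t ≡? 1ℤ [mod m ]) witness
  where
  open Residue m
  witness : ∃[ t ] 1 ℕ.≤ t × n ^ t ≡ 1ℤ [mod m ]
  witness with collision (λ i → residue (n ^ i))
  ... | i , d , 1≤d , eq =
    d , 1≤d , pow-return m n c i d (residue-≡ (n ^ (i ℕ.+ d)) (n ^ i) eq)

period-exists : ∀ {p} → Prime p → ∀ A B → ¬ (+ p ∣ B) → ∃ (IsPeriod p A B)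
period-exists {p} pr A B p∤B = least-positive
  (λ i → (E A B i ≡? 0ℤ [mod p ]) ×-dec (E A B (suc i) ≡? 1ℤ [mod p ])) witness
  where
  instance _ = prime⇒nonZero pr
  open Residue p
  e = E A B
  witness : ∃[ i ] 1 ℕ.≤ i × e i ≡ 0ℤ [mod p ] × e (suc i) ≡ 1ℤ [mod p ]
  witness with collision (λ i → combine (residue (e i)) (residue (e (suc i))))
  ... | i , d , 1≤d , eq
    with eq₀ , eq₁ ← combine-injective _ (residue (e (suc (i ℕ.+ d)))) _ _ eq =
    d , 1≤d , E-return p A B (∤⇒coprime pr B p∤B) i d
      (residue-≡ (e (i ℕ.+ d)) (e i) eq₀)
      (residue-≡ (e (suc i ℕ.+ d)) (e (suc i)) eq₁)

ord : ∀ {p} → Prime p → ∀ n → Coprime (+ p) n → ℕ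
ord {p} pr n c = proj₁ (ord-exists p {{prime⇒nonZero pr}} n c)

period : ∀ {p} → Prime p → ∀ A B → ¬ (+ p ∣ B) → ℕ
period pr A B p∤B = proj₁ (period-exists pr A B p∤B)

nonresidue⇒∤B : ∀ {p} A B → QuadraticNonresidue p (A ^ 2 + + 4 * B) → ¬ (+ p ∣ B)
nonresidue⇒∤B {p} A B (_ , nonsquare) p∣B =
  nonsquare (A , subst (+ p ∣_) (diff (A ^ 2) B) (∣n⇒∣m*n (- (+ 4)) p∣B))
  where
  diff : ∀ s B → - (+ 4) * B ≡ s - (s + + 4 * B)
  diff = solve-∀

∤⇒coprime-square : ∀ {p} → Prime p → ∀ n → ¬ (+ p ∣ n) → Coprime (+ p) (n ^ 2)
∤⇒coprime-square {p} pr n p∤n = ∤⇒coprime pr (n ^ 2) λ p∣n² →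
  [ p∤n ∘ ∣ᵤ⇒∣ , p∤n ∘ ∣ᵤ⇒∣ ]′
    (euclidsLemma ∣ n ∣ ∣ n ∣ pr
      (subst (p ℕ.∣_)
        (trans (cong (λ x → ∣ n * x ∣) (*-identityʳ n)) (abs-* n n))
        (∣⇒∣ᵤ p∣n²)))

{-# OPTIONS --safe #-}

-- In the ring R = (ℤ/p)[α]/(α² − Aα − B) one has αⁿ = (Eₙ₊₁ − A Eₙ) + Eₙ α, so
-- k is the order of α.  The element δ = 2α − A satisfies δ² = Δ, and Euler's
-- criterion Δ^((p−1)/2) = −1 gives δᵖ = −δ.  Frobenius is additive on R and
-- fixes A, hence 2αᵖ = A − δ = 2(A − α) and αᵖ⁺¹ = α(A − α) = −B.  Therefore
-- α^(2(p+1)·ord(B²)) = (B²)^ord(B²) = 1.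
-- Euler's criterion follows from Lagrange's bound on roots: if Δ^((p−1)/2) were 1,
-- then Δ and the squares 1², …, ((p−1)/2)² would be (p+1)/2 roots of X^((p−1)/2) − 1.

module Submission where

open import Defs
open import Algebra.Bundles using (CommutativeSemiring)
open import Algebra.Structures.Biased using (isCommutativeSemiringˡ)
open import Data.Nat.Base using (ℕ; zero; suc; _+_; _*_; _∸_; _≤_; _<_; z≤n; s≤s; >-nonZero)
open import Data.Nat.Combinatorics using (_C_; nC1≡n; nCn≡1; k>n⇒nCk≡0; nCk+nC[k+1]≡[n+1]C[k+1])
open import Data.Nat.Divisibility using (_∣_; divides; ∣-refl; ∣⇒≤; ∣1⇒≡1; m%n≡0⇒n∣m; m∣m*n)
open import Data.Nat.DivMod using (_%_; _/_; m%n<n; m≡m%n+[m/n]*n)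
open import Data.Nat.Primality using (Prime; ¬prime[0]; ¬prime[1]; euclidsLemma; prime⇒nonZero)
import Data.Nat.Properties as ℕ
import Data.Nat.Tactic.RingSolver as ℕ-Solver
open import Data.Fin.Base as Fin using (toℕ; fromℕ; inject₁)
open import Data.Fin.Properties using (toℕ<n; toℕ-fromℕ; toℕ-inject₁)
open import Data.Integer.Base as ℤ using (ℤ; +_)
open import Data.Integer.DivMod using (_%ℕ_; _/ℕ_; a≡a%ℕn+[a/ℕn]*n)
import Data.Integer.Divisibility.Signed as ℤ
import Data.Integer.Properties as ℤ
open import Data.Integer.Tactic.RingSolver using (solve-∀)
open import Data.Product.Base using (_×_; _,_; proj₁; proj₂)
open import Data.Sum.Base as Sum using (_⊎_; inj₁; inj₂; [_,_]′)
open import Data.Vec.Base using (Vec; []; _∷_; replicate)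
open import Function.Base using (_∘_; id)
open import Level using (0ℓ)
open import Relation.Binary.Structures using (IsEquivalence)
open import Relation.Nullary using (¬_; contradiction)
open import Relation.Binary.PropositionalEquality
  using (_≡_; refl; sym; trans; cong; cong₂; subst; module ≡-Reasoning)

-- Binomial coefficients modulo a prime and the Frobenius map.

-- The absorption identity, by induction through Pascal's rule. It is kept free of division so that
-- Euclid's lemma can be applied to the product.
[1+k]*[1+n]C[1+k] : ∀ n k → suc k * (suc n C suc k) ≡ suc n * (n C k)
[1+k]*[1+n]C[1+k] n       zero    =
  trans (ℕ.*-identityˡ _) (trans (nC1≡n (suc n)) (sym (ℕ.*-identityʳ _)))
[1+k]*[1+n]C[1+k] zero    (suc k) = begin
  suc (suc k) * (1 C suc (suc k)) ≡⟨ cong (suc (suc k) *_) (k>n⇒nCk≡0 {1} {suc (suc k)} (s≤s (s≤s z≤n))) ⟩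
  suc (suc k) * 0                 ≡⟨ ℕ.*-zeroʳ (suc (suc k)) ⟩
  1 * 0                           ≡⟨ cong (1 *_) (k>n⇒nCk≡0 {0} {suc k} (s≤s z≤n)) ⟨
  1 * (0 C suc k)                 ∎
  where open ≡-Reasoning
[1+k]*[1+n]C[1+k] (suc n) (suc k) = begin
  suc (suc k) * (suc (suc n) C suc (suc k))
    ≡⟨ cong (suc (suc k) *_) (nCk+nC[k+1]≡[n+1]C[k+1] (suc n) (suc k)) ⟨
  suc (suc k) * (c + (suc n C suc (suc k)))
    ≡⟨ split k c _ ⟩
  suc k * c + c + suc (suc k) * (suc n C suc (suc k))
    ≡⟨ cong₂ (λ u v → u + c + v) ([1+k]*[1+n]C[1+k] n k) ([1+k]*[1+n]C[1+k] n (suc k)) ⟩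
  suc n * (n C k) + c + suc n * (n C suc k)
    ≡⟨ collect n c (n C k) (n C suc k) ⟩
  c + suc n * ((n C k) + (n C suc k))
    ≡⟨ cong (λ u → c + suc n * u) (nCk+nC[k+1]≡[n+1]C[k+1] n k) ⟩
  suc (suc n) * c ∎
  where
  open ≡-Reasoning
  c = suc n C suc k
  split : ∀ k c d → suc (suc k) * (c + d) ≡ suc k * c + c + suc (suc k) * d
  split = ℕ-Solver.solve-∀
  collect : ∀ n c u v → suc n * u + c + suc n * v ≡ c + suc n * (u + v)
  collect = ℕ-Solver.solve-∀

-- By absorption the prime divides `suc k * (suc m C suc k)`, and `suc k` is positive and too small
-- to be a multiple of it.
prime∣C : ∀ {m} → Prime (suc m) → ∀ k → k < m → suc m ∣ suc m C suc k
prime∣C {m} pr k k<m with euclidsLemma (suc k) (suc m C suc k) pr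
  (subst (suc m ∣_) (sym ([1+k]*[1+n]C[1+k] m k)) (m∣m*n (m C k)))
... | inj₁ p∣1+k = contradiction (∣⇒≤ p∣1+k) (ℕ.<⇒≱ (s≤s k<m))
... | inj₂ p∣C   = p∣C

module _ {c ℓ} (S : CommutativeSemiring c ℓ) where

  open CommutativeSemiring S renaming (_+_ to _⊕_; _*_ to _⊗_; refl to ∼-refl; sym to ∼-sym; trans to ∼-trans)
  open import Algebra.Properties.CommutativeSemiring.Binomial S using (binomialTerm; theorem)
  open import Algebra.Properties.CommutativeSemiring.Exp S using (_^_)
  open import Algebra.Properties.Semiring.Mult semiring using (×-assocˡ; ×-homo-1; ×-congˡ) renaming (_×_ to _·_)
  open import Algebra.Properties.Semiring.Sum semiring
    using (sum; sum-cong-≋; sum-init-last; sum-replicate-zero)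
  open import Relation.Binary.Reasoning.Setoid setoid

  -- All inner terms of the binomial expansion vanish. Stating it for any semiring of characteristic
  -- p serves both the integers modulo p and their quadratic extension.
  frobenius : ∀ {p} → Prime p → (∀ x → p · x ≈ 0#) →
              ∀ x y → (x ⊕ y) ^ p ≈ x ^ p ⊕ y ^ p
  frobenius {zero}  pr char x y = contradiction pr ¬prime[0]
  frobenius {suc m} pr char x y = begin
    (x ⊕ y) ^ p
      ≈⟨ theorem p x y ⟩
    term Fin.zero ⊕ sum (λ k → term (Fin.suc k))
      ≈⟨ +-congˡ (sum-init-last {m} (λ k → term (Fin.suc k))) ⟩
    term Fin.zero ⊕ (sum (λ k → term (Fin.suc (inject₁ k))) ⊕ term (fromℕ p))
      ≈⟨ +-cong first (+-cong middle last) ⟩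
    -- The term of index k carries `x ^ k`, so index 0 gives `y ^ p` and index p gives `x ^ p`.
    y ^ p ⊕ (0# ⊕ x ^ p)
      ≈⟨ +-congˡ (+-identityˡ (x ^ p)) ⟩
    y ^ p ⊕ x ^ p
      ≈⟨ +-comm (y ^ p) (x ^ p) ⟩
    x ^ p ⊕ y ^ p ∎
    where
    p = suc m
    term = binomialTerm x y p

    vanish : ∀ {n} → p ∣ n → ∀ z → n · z ≈ 0#
    vanish (divides q refl) z = begin
      (q * p) · z   ≈⟨ ×-congˡ (ℕ.*-comm q p) ⟩
      (p * q) · z   ≈⟨ ×-assocˡ z p q ⟨
      p · (q · z)   ≈⟨ char (q · z) ⟩
      0#            ∎

    first : term Fin.zero ≈ y ^ p
    first = ∼-trans (×-homo-1 _) (*-identityˡ (y ^ p))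

    middle : sum (λ k → term (Fin.suc (inject₁ k))) ≈ 0#
    middle = ∼-trans
      (sum-cong-≋ {m} λ k → vanish
        (prime∣C pr (toℕ (inject₁ k)) (subst (_< m) (sym (toℕ-inject₁ k)) (toℕ<n k))) _)
      (sum-replicate-zero m)

    last : term (fromℕ p) ≈ x ^ p
    last rewrite toℕ-fromℕ m | nCn≡1 p | ℕ.n∸n≡0 m = ∼-trans (×-homo-1 _) (*-identityʳ (x ^ p))

-- Exponents with trivial power are multiples of the least one.

module _ {c} (S : CommutativeSemiring c 0ℓ) where

  open CommutativeSemiring S renaming (_+_ to _⊕_; _*_ to _⊗_; refl to ∼-refl; sym to ∼-sym; trans to ∼-trans)
  open import Algebra.Properties.CommutativeSemiring.Exp S
  open import Relation.Binary.Reasoning.Setoid setoid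

  1^n≈1 : ∀ n → 1# ^ n ≈ 1#
  1^n≈1 zero    = ∼-refl
  1^n≈1 (suc n) = ∼-trans (*-identityˡ (1# ^ n)) (1^n≈1 n)

  -- Multiplying `x ^ (n % k)` by a power of `x ^ k ≈ 1#` restores `x ^ n`, so the remainder is
  -- itself such an exponent; being below k, it is 0 by minimality.
  least-period∣ : ∀ x {k} → IsLeastPositive (λ i → x ^ i ≈ 1#) k →
                  ∀ n → x ^ n ≈ 1# → k ∣ n
  least-period∣ x {k} (1≤k , xᵏ≈1 , least) n xⁿ≈1 = m%n≡0⇒n∣m n k (r≡0 (n % k) (m%n<n n k) xʳ≈1)
    where
    instance _ = >-nonZero 1≤k

    xʳ≈1 : x ^ (n % k) ≈ 1#
    xʳ≈1 = begin
      x ^ (n % k)                         ≈⟨ *-identityʳ _ ⟨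
      x ^ (n % k) ⊗ 1#                    ≈⟨ *-congˡ (1^n≈1 (n / k)) ⟨
      x ^ (n % k) ⊗ 1# ^ (n / k)          ≈⟨ *-congˡ (^-congˡ (n / k) xᵏ≈1) ⟨
      x ^ (n % k) ⊗ (x ^ k) ^ (n / k)     ≈⟨ *-congˡ (^-assocʳ x k (n / k)) ⟩
      x ^ (n % k) ⊗ x ^ (k * (n / k))     ≈⟨ ^-homo-* x (n % k) (k * (n / k)) ⟨
      x ^ (n % k + k * (n / k))           ≈⟨ ^-congʳ x (cong (λ j → n % k + j) (ℕ.*-comm k (n / k))) ⟩
      x ^ (n % k + n / k * k)             ≈⟨ ^-congʳ x (m≡m%n+[m/n]*n n k) ⟨
      x ^ n                               ≈⟨ xⁿ≈1 ⟩
      1#                                  ∎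

    r≡0 : ∀ r → r < k → x ^ r ≈ 1# → r ≡ 0
    r≡0 zero    _   _    = refl
    r≡0 (suc r) r<k xʳ≈1 = contradiction (least (suc r) (s≤s z≤n) xʳ≈1) (ℕ.<⇒≱ r<k)

-- Integers modulo m and Fermat's little theorem.

∣⇒≡0[mod] : ∀ m {a} → + m ℤ.∣ a → a ≡ + 0 [mod m ]
∣⇒≡0[mod] m {a} = subst (+ m ℤ.∣_) (sym (ℤ.+-identityʳ a))

-- Unlike _≡_[mod_], which unfolds to a divisibility of a - b, the record lets Agda
-- infer a and b.
infix 4 _≈_[_]

record _≈_[_] (a b : ℤ) (m : ℕ) : Set where
  constructor mod
  field unmod : a ≡ b [mod m ]
open _≈_[_]

≡⇒≈ : ∀ {m a b} → a ≡ b → a ≈ b [ m ]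
≡⇒≈ {m} {a} refl = mod (∣⇒≡0 (ℤ.+-inverseʳ a))
  where
  ∣⇒≡0 : ∀ {x} → x ≡ + 0 → + m ℤ.∣ x
  ∣⇒≡0 refl = ℤ.divides (+ 0) refl

≈-sym : ∀ {m a b} → a ≈ b [ m ] → b ≈ a [ m ]
≈-sym {m} {a} {b} (mod h) = mod (subst (+ m ℤ.∣_) (flip a b) (ℤ.∣m⇒∣-m h))
  where
  flip : ∀ a b → ℤ.- (a ℤ.- b) ≡ b ℤ.- a
  flip = solve-∀

≈-trans : ∀ {m a b c} → a ≈ b [ m ] → b ≈ c [ m ] → a ≈ c [ m ]
≈-trans {m} {a} {b} {c} (mod h) (mod h′) =
  mod (subst (+ m ℤ.∣_) (telescope a b c) (ℤ.∣m∣n⇒∣m+n h h′))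
  where
  telescope : ∀ a b c → a ℤ.- b ℤ.+ (b ℤ.- c) ≡ a ℤ.- c
  telescope = solve-∀

+-cong-≈ : ∀ {m a b c d} → a ≈ b [ m ] → c ≈ d [ m ] → a ℤ.+ c ≈ b ℤ.+ d [ m ]
+-cong-≈ {m} {a} {b} {c} {d} (mod h) (mod h′) =
  mod (subst (+ m ℤ.∣_) (regroup a b c d) (ℤ.∣m∣n⇒∣m+n h h′))
  where
  regroup : ∀ a b c d → a ℤ.- b ℤ.+ (c ℤ.- d) ≡ a ℤ.+ c ℤ.- (b ℤ.+ d)
  regroup = solve-∀

*-cong-≈ : ∀ {m a b c d} → a ≈ b [ m ] → c ≈ d [ m ] → a ℤ.* c ≈ b ℤ.* d [ m ]
*-cong-≈ {m} {a} {b} {c} {d} (mod h) (mod h′) =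
  mod (subst (+ m ℤ.∣_) (regroup a b c d) (ℤ.∣m∣n⇒∣m+n (ℤ.∣m⇒∣m*n c h) (ℤ.∣n⇒∣m*n b h′)))
  where
  regroup : ∀ a b c d → (a ℤ.- b) ℤ.* c ℤ.+ b ℤ.* (c ℤ.- d) ≡ a ℤ.* c ℤ.- b ℤ.* d
  regroup = solve-∀

≈-isEquivalence : ∀ {m} → IsEquivalence _≈_[ m ]
≈-isEquivalence = record { refl = ≡⇒≈ refl ; sym = ≈-sym ; trans = ≈-trans }

-- The carrier stays ℤ and only its equality is coarsened to congruence; no quotient type is formed.
ℤ/ : ℕ → CommutativeSemiring 0ℓ 0ℓ
ℤ/ m = record
  { Carrier = ℤ
  ; _≈_ = _≈_[ m ]
  ; _+_ = ℤ._+_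
  ; _*_ = ℤ._*_
  ; 0# = + 0
  ; 1# = + 1
  ; isCommutativeSemiring = isCommutativeSemiringˡ record
    { +-isCommutativeMonoid = record
      { isMonoid = record
        { isSemigroup = record
          { isMagma = record
            { isEquivalence = ≈-isEquivalence
            ; ∙-cong = +-cong-≈
            }
          ; assoc = λ a b c → ≡⇒≈ (ℤ.+-assoc a b c)
          }
        ; identity = (λ a → ≡⇒≈ (ℤ.+-identityˡ a)) , (λ a → ≡⇒≈ (ℤ.+-identityʳ a))
        }
      ; comm = λ a b → ≡⇒≈ (ℤ.+-comm a b)
      }
    ; *-isCommutativeMonoid = record
      { isMonoid = record
        { isSemigroup = record
          { isMagma = record
            { isEquivalence = ≈-isEquivalence
            ; ∙-cong = *-cong-≈
            }
          ; assoc = λ a b c → ≡⇒≈ (ℤ.*-assoc a b c)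
          }
        ; identity = (λ a → ≡⇒≈ (ℤ.*-identityˡ a)) , (λ a → ≡⇒≈ (ℤ.*-identityʳ a))
        }
      ; comm = λ a b → ≡⇒≈ (ℤ.*-comm a b)
      }
    ; distribʳ = λ a b c → ≡⇒≈ (ℤ.*-distribʳ-+ a b c)
    ; zeroˡ = λ a → ≡⇒≈ (ℤ.*-zeroˡ a)
    }
  }

-- After replacing a by its residue, induction on that natural number works because Frobenius gives
-- (1 + n)^p = 1 + n^p.
fermat : ∀ {p} → Prime p → ∀ a → a ℤ.^ p ≡ a [mod p ]
fermat {p} pr a = unmod (begin
  a ℤ.^ p       ≡⟨ ^≡^ a p ⟨
  a ^ p         ≈⟨ ^-congˡ p a≈r ⟩
  (+ r) ^ p     ≈⟨ fermat-ℕ r ⟩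
  + r           ≈⟨ a≈r ⟨
  a             ∎)
  where
  open CommutativeSemiring (ℤ/ p) using (+-cong; setoid; semiring)
  open import Algebra.Properties.CommutativeSemiring.Exp (ℤ/ p)
  open import Algebra.Properties.Semiring.Mult semiring using () renaming (_×_ to _·_)
  open import Relation.Binary.Reasoning.Setoid setoid
  instance _ = prime⇒nonZero pr

  r = a %ℕ p

  ·≡* : ∀ n x → n · x ≡ + n ℤ.* x
  ·≡* zero    x = refl
  ·≡* (suc n) x = trans (cong (λ y → x ℤ.+ y) (·≡* n x)) (sym (ℤ.suc-* (+ n) x))

  ^≡^ : ∀ x n → x ^ n ≡ x ℤ.^ n
  ^≡^ x zero    = refl
  ^≡^ x (suc n) = cong (x ℤ.*_) (^≡^ x n)

  a≈r : a ≈ + r [ p ]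
  a≈r = mod (ℤ.divides (a /ℕ p)
    (trans (cong (ℤ._- + r) (a≡a%ℕn+[a/ℕn]*n a p)) (cancel (+ r) (a /ℕ p ℤ.* + p))))
    where
    cancel : ∀ r q → r ℤ.+ q ℤ.- r ≡ q
    cancel = solve-∀

  char : ∀ x → p · x ≈ + 0 [ p ]
  char x = mod (∣⇒≡0[mod] p (subst (+ p ℤ.∣_) (sym (·≡* p x)) (ℤ.∣m⇒∣m*n x ℤ.∣-refl)))

  -- It binds its own p so that the exponent can be split; primality excludes 0 ^ 0 = 1.
  0^p≡0 : ∀ {p} → Prime p → (+ 0) ^ p ≡ + 0
  0^p≡0 {zero}  pr = contradiction pr ¬prime[0]
  0^p≡0 {suc _} pr = refl

  fermat-ℕ : ∀ n → (+ n) ^ p ≈ + n [ p ]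
  fermat-ℕ zero    = ≡⇒≈ (0^p≡0 pr)
  fermat-ℕ (suc n) = begin
    (+ 1 ℤ.+ + n) ^ p           ≈⟨ frobenius (ℤ/ p) pr char (+ 1) (+ n) ⟩
    (+ 1) ^ p ℤ.+ (+ n) ^ p     ≈⟨ +-cong (1^n≈1 (ℤ/ p) p) (fermat-ℕ n) ⟩
    + 1 ℤ.+ + n                 ∎

euclidℤ : ∀ {p} → Prime p → ∀ a b → + p ℤ.∣ a ℤ.* b → + p ℤ.∣ a ⊎ + p ℤ.∣ b
euclidℤ {p} pr a b p∣ab = Sum.map ℤ.∣ᵤ⇒∣ ℤ.∣ᵤ⇒∣
  (euclidsLemma ℤ.∣ a ∣ ℤ.∣ b ∣ pr (subst (p ∣_) (ℤ.abs-* a b) (ℤ.∣⇒∣ᵤ p∣ab)))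

-- Euclid's lemma cancels a from `a * (a ^ n - 1)`. The equation `p ≡ suc n` avoids a truncated p -
-- 1 in the exponent.
∤⇒^[p-1]≡1 : ∀ {p n} → Prime p → p ≡ suc n → ∀ a → ¬ (+ p ℤ.∣ a) → a ℤ.^ n ≡ + 1 [mod p ]
∤⇒^[p-1]≡1 {p} {n} pr refl a p∤a =
  [ (λ p∣a → contradiction p∣a p∤a) , id ]′
    (euclidℤ pr a (a ℤ.^ n ℤ.- + 1)
      (subst (+ p ℤ.∣_) (factor a (a ℤ.^ n)) (fermat pr a)))
  where
  factor : ∀ a b → a ℤ.* b ℤ.- a ≡ a ℤ.* (b ℤ.- + 1)
  factor = solve-∀

-- Monic integer polynomials and their roots modulo a prime.

-- A vector of length n holds the lower coefficients, constant term first, of a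
-- monic polynomial of degree n.
monic : ∀ {n} → Vec ℤ n → ℤ → ℤ
monic []       x = + 1
monic (c ∷ cs) x = c ℤ.+ x ℤ.* monic cs x

-- Synthetic division by X - r: each quotient coefficient is the value at r of the polynomial formed
-- by the higher coefficients.
divide : ∀ {n} → ℤ → Vec ℤ (suc n) → Vec ℤ n
divide r (c ∷ [])           = []
divide r (c ∷ cs@(_ ∷ _)) = monic cs r ∷ divide r cs

-- For f = c + X g one has f(x) - f(r) = x (g(x) - g(r)) + (x - r) g(r); induction applies to g.
divide-correct : ∀ {n} r (cs : Vec ℤ (suc n)) x →
                 monic cs x ℤ.- monic cs r ≡ (x ℤ.- r) ℤ.* monic (divide r cs) x
divide-correct r (c ∷ []) x = linear c x r
  where
  linear : ∀ c x r → c ℤ.+ x ℤ.* + 1 ℤ.- (c ℤ.+ r ℤ.* + 1) ≡ (x ℤ.- r) ℤ.* + 1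
  linear = solve-∀
divide-correct r (c ∷ cs@(_ ∷ _)) x =
  trans (split c x r (monic cs x) (monic cs r))
  (trans (cong (λ d → x ℤ.* d ℤ.+ (x ℤ.- r) ℤ.* monic cs r) (divide-correct r cs x))
         (collect x r (monic cs r) (monic (divide r cs) x)))
  where
  split : ∀ c x r u v → c ℤ.+ x ℤ.* u ℤ.- (c ℤ.+ r ℤ.* v) ≡ x ℤ.* (u ℤ.- v) ℤ.+ (x ℤ.- r) ℤ.* v
  split = solve-∀
  collect : ∀ x r v q → x ℤ.* ((x ℤ.- r) ℤ.* q) ℤ.+ (x ℤ.- r) ℤ.* v ≡ (x ℤ.- r) ℤ.* (v ℤ.+ x ℤ.* q)
  collect = solve-∀

-- Splitting off the last root leaves a quotient of lower degree, which vanishes at the remaining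
-- roots because their differences from the last are prime to p. In degree 0 the value is 1, which p
-- cannot divide.
lagrange : ∀ {p} → Prime p → ∀ {n} (cs : Vec ℤ n) (r : ℕ → ℤ) →
           (∀ i j → i < j → j ≤ n → ¬ r j ≡ r i [mod p ]) →
           ¬ (∀ i → i ≤ n → + p ℤ.∣ monic cs (r i))
lagrange {p} pr [] r distinct roots = contradiction pr
  (subst (¬_ ∘ Prime) (sym (∣1⇒≡1 (ℤ.∣⇒∣ᵤ (roots 0 z≤n)))) ¬prime[1])
lagrange {p} pr {suc n} cs@(_ ∷ _) r distinct roots =
  lagrange pr (divide (r (suc n)) cs) r
    (λ i j i<j j≤n → distinct i j i<j (ℕ.m≤n⇒m≤1+n j≤n))
    (λ i i≤n →
      [ (λ h → contradiction (unmod (≈-sym (mod {r i} {r (suc n)} h)))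
                 (distinct i (suc n) (s≤s i≤n) ℕ.≤-refl)) , id ]′
        (euclidℤ pr (r i ℤ.- r (suc n)) _
          (subst (+ p ℤ.∣_) (divide-correct (r (suc n)) cs (r i))
            (ℤ.∣m∣n⇒∣m-n (roots i (ℕ.m≤n⇒m≤1+n i≤n)) (roots (suc n) ℕ.≤-refl)))))

monic-zeros : ∀ n x → monic (replicate n (+ 0)) x ≡ x ℤ.^ n
monic-zeros zero    x = refl
monic-zeros (suc n) x = trans (ℤ.+-identityˡ _) (cong (x ℤ.*_) (monic-zeros n x))

-- Euler's criterion for nonresidues.

odd⇒≡1+2* : ∀ p → ¬ (2 ∣ p) → p ≡ suc (2 * (p / 2))
odd⇒≡1+2* p 2∤p with p % 2 in eq | m%n<n p 2 | m≡m%n+[m/n]*n p 2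
... | 0           | _                   | _ = contradiction (m%n≡0⇒n∣m p 2 eq) 2∤p
... | 1           | _                   | e = trans e (cong suc (ℕ.*-comm (p / 2) 2))
... | suc (suc _) | s≤s (s≤s ()) | _

-- The difference of the squares is (j - i)(j + i + 2), and both factors lie strictly between 0 and
-- p because `suc j ≤ h` and 2h < p.
squares-distinct : ∀ {p h} → Prime p → p ≡ suc (2 * h) → ∀ i j → i < j → suc j ≤ h →
                   ¬ (+ suc j) ℤ.^ 2 ≡ (+ suc i) ℤ.^ 2 [mod p ]
squares-distinct {p} {h} pr p≡ i j i<j j<h sq = [ no (ℕ.m<n⇒0<n∸m i<j) j∸i<p , no (s≤s z≤n) sum<p ]′
  (euclidsLemma (j ∸ i) (suc j + suc i) pr (ℤ.∣⇒∣ᵤ (subst (+ p ℤ.∣_) diff sq)))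
  where
  no : ∀ {n} → 0 < n → n < p → ¬ (p ∣ n)
  no 0<n n<p p∣n = contradiction (∣⇒≤ {{>-nonZero 0<n}} p∣n) (ℕ.<⇒≱ n<p)
  2h<p : 2 * h < p
  2h<p = subst (2 * h <_) (sym p≡) ℕ.≤-refl
  sum<p : suc j + suc i < p
  sum<p = ℕ.≤-<-trans
    (ℕ.+-mono-≤ j<h (ℕ.≤-trans (s≤s (ℕ.<⇒≤ i<j)) (subst (suc j ≤_) (sym (ℕ.+-identityʳ h)) j<h))) 2h<p
  j∸i<p : j ∸ i < p
  j∸i<p = ℕ.≤-<-trans (ℕ.≤-trans (ℕ.m∸n≤m j i) (ℕ.≤-trans (ℕ.n≤1+n j) (ℕ.m≤m+n (suc j) (suc i)))) sum<p
  -- The ring solver does not normalise powers, so x ^ 2 is unfolded to x * (x * 1).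
  factor : ∀ d i → (+ 1 ℤ.+ (d ℤ.+ i)) ℤ.* ((+ 1 ℤ.+ (d ℤ.+ i)) ℤ.* + 1) ℤ.-
                   (+ 1 ℤ.+ i) ℤ.* ((+ 1 ℤ.+ i) ℤ.* + 1) ≡
                   d ℤ.* ((+ 1 ℤ.+ (d ℤ.+ i)) ℤ.+ (+ 1 ℤ.+ i))
  factor = solve-∀
  diff : (+ suc j) ℤ.^ 2 ℤ.- (+ suc i) ℤ.^ 2 ≡ + ((j ∸ i) * (suc j + suc i))
  -- The polynomial identity is in d = j - i and i, so j is reached from `j ∸ i + i`.
  diff = subst (λ k → (+ suc k) ℤ.^ 2 ℤ.- (+ suc i) ℤ.^ 2 ≡ + ((j ∸ i) * (suc k + suc i)))
    (ℕ.m∸n+n≡m (ℕ.<⇒≤ i<j))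
    (trans (factor (+ (j ∸ i)) (+ i)) (sym (ℤ.pos-* (j ∸ i) (suc (j ∸ i + i) + suc i))))

euler-criterion : ∀ {p h} → Prime p → p ≡ suc (2 * h) → ∀ Δ → QuadraticNonresidue p Δ →
                  Δ ℤ.^ h ≡ ℤ.- + 1 [mod p ]
euler-criterion {p} {zero}  pr refl Δ nonres = contradiction pr ¬prime[1]
euler-criterion {p} {suc n} pr p≡ Δ (p∤Δ , nonsquare) =
  -- p divides (Δ^h - 1)(Δ^h + 1) = Δ^(p-1) - 1. Counting roots excludes the first factor; the
  -- second is the claim, since `- (- 1)` computes to 1.
  [ (λ Δʰ≡1 → contradiction (roots Δʰ≡1) (lagrange pr f r distinct)) , id ]′
    (euclidℤ pr (Δ ℤ.^ h ℤ.- + 1) (Δ ℤ.^ h ℤ.+ + 1)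
      (subst (+ p ℤ.∣_)
        (trans (cong (ℤ._- + 1) Δ²ʰ≡) (factor (Δ ℤ.^ h)))
        (∤⇒^[p-1]≡1 pr p≡ Δ p∤Δ)))
  where
  h = suc n
  f : Vec ℤ h
  -- This is X^h - 1.
  f = ℤ.- + 1 ∷ replicate n (+ 0)
  r : ℕ → ℤ
  -- The indices 0 to h give h + 1 candidates, one more than the degree. Index 0 differs from the
  -- others because Δ is not a square.
  r zero    = Δ
  r (suc i) = (+ suc i) ℤ.^ 2

  factor : ∀ x → x ℤ.* x ℤ.- + 1 ≡ (x ℤ.- + 1) ℤ.* (x ℤ.+ + 1)
  factor = solve-∀
  Δ²ʰ≡ : Δ ℤ.^ (2 * h) ≡ Δ ℤ.^ h ℤ.* Δ ℤ.^ h
  Δ²ʰ≡ = trans (cong (λ k → Δ ℤ.^ (h + k)) (ℕ.+-identityʳ h)) (ℤ.^-distribˡ-+-* Δ h h)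

  distinct : ∀ i j → i < j → j ≤ h → ¬ r j ≡ r i [mod p ]
  distinct zero    (suc j) _         _   sq = nonsquare (+ suc j , sq)
  distinct (suc i) (suc j) (s≤s i<j) j≤h sq = squares-distinct pr p≡ i j i<j j≤h sq

  h<p : h < p
  h<p = subst (h <_) (sym p≡) (s≤s (ℕ.m≤m+n h (h + 0)))

  rʰ≡1 : Δ ℤ.^ h ≡ + 1 [mod p ] → ∀ i → i ≤ h → r i ℤ.^ h ≡ + 1 [mod p ]
  rʰ≡1 Δʰ≡1 zero    _   = Δʰ≡1
  -- The h-th power of a square is a (p-1)-st power, and the base `suc i` is at most h < p.
  rʰ≡1 Δʰ≡1 (suc i) i<h = subst (_≡ + 1 [mod p ]) (sym (ℤ.^-*-assoc (+ suc i) 2 h))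
    (∤⇒^[p-1]≡1 pr p≡ (+ suc i) λ p∣ → contradiction (∣⇒≤ (ℤ.∣⇒∣ᵤ p∣)) (ℕ.<⇒≱ (ℕ.≤-<-trans i<h h<p)))

  f≡ : ∀ x → x ℤ.^ h ℤ.- + 1 ≡ monic f x
  f≡ x = trans (ℤ.+-comm (x ℤ.^ h) (ℤ.- + 1)) (cong (λ y → ℤ.- + 1 ℤ.+ x ℤ.* y) (sym (monic-zeros n x)))

  roots : Δ ℤ.^ h ≡ + 1 [mod p ] → ∀ i → i ≤ h → + p ℤ.∣ monic f (r i)
  roots Δʰ≡1 i i≤h = subst (+ p ℤ.∣_) (f≡ (r i)) (rʰ≡1 Δʰ≡1 i i≤h)

-- The quadratic ring and the powers of α as terms of E.

module QuadraticExtension (m : ℕ) (A B : ℤ) where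

  infix 4 _∼_
  infixl 6 _⊕_
  infixl 7 _⊗_

  -- a , b stands for a + b α, where α² = A α + B.
  record _∼_ (x y : ℤ × ℤ) : Set where
    constructor _,_
    field
      re : proj₁ x ≈ proj₁ y [ m ]
      im : proj₂ x ≈ proj₂ y [ m ]
  open _∼_ public

  _⊕_ _⊗_ : ℤ × ℤ → ℤ × ℤ → ℤ × ℤ
  (a , b) ⊕ (c , d) = a ℤ.+ c , b ℤ.+ d
  (a , b) ⊗ (c , d) = a ℤ.* c ℤ.+ B ℤ.* (b ℤ.* d) , a ℤ.* d ℤ.+ b ℤ.* c ℤ.+ A ℤ.* (b ℤ.* d)

  ι : ℤ → ℤ × ℤ
  ι a = a , + 0

  α : ℤ × ℤ
  α = + 0 , + 1

  ≡⇒∼ : ∀ {a b c d} → a ≡ c → b ≡ d → (a , b) ∼ (c , d)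
  ≡⇒∼ e e′ = ≡⇒≈ e , ≡⇒≈ e′

  ring : CommutativeSemiring 0ℓ 0ℓ
  ring = record
    { Carrier = ℤ × ℤ
    ; _≈_ = _∼_
    ; _+_ = _⊕_
    ; _*_ = _⊗_
    ; 0# = ι (+ 0)
    ; 1# = ι (+ 1)
    ; isCommutativeSemiring = isCommutativeSemiringˡ record
      { +-isCommutativeMonoid = record
        { isMonoid = record
          { isSemigroup = record
            { isMagma = record
              { isEquivalence = ∼-isEquivalence
              ; ∙-cong = λ (h , h′) (k , k′) → +-cong-≈ h k , +-cong-≈ h′ k′
              }
            ; assoc = λ (a , b) (c , d) (e , f) → ≡⇒∼ (ℤ.+-assoc a c e) (ℤ.+-assoc b d f)
            }
          ; identity = (λ (a , b) → ≡⇒∼ (ℤ.+-identityˡ a) (ℤ.+-identityˡ b))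
                     , (λ (a , b) → ≡⇒∼ (ℤ.+-identityʳ a) (ℤ.+-identityʳ b))
          }
        ; comm = λ (a , b) (c , d) → ≡⇒∼ (ℤ.+-comm a c) (ℤ.+-comm b d)
        }
      ; *-isCommutativeMonoid = record
        { isMonoid = record
          { isSemigroup = record
            { isMagma = record
              { isEquivalence = ∼-isEquivalence
              ; ∙-cong = λ (h , h′) (k , k′) →
                  +-cong-≈ (*-cong-≈ h k) (*-cong-≈ (≡⇒≈ {a = B} refl) (*-cong-≈ h′ k′))
                , +-cong-≈ (+-cong-≈ (*-cong-≈ h k′) (*-cong-≈ h′ k))
                           (*-cong-≈ (≡⇒≈ {a = A} refl) (*-cong-≈ h′ k′))
              }
            ; assoc = λ (a , b) (c , d) (e , f) → ≡⇒∼ (assoc₁ A B a b c d e f) (assoc₂ A B a b c d e f)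
            }
          ; identity = (λ (a , b) → ≡⇒∼ (idˡ₁ B a b) (idˡ₂ A a b))
                     , (λ (a , b) → ≡⇒∼ (idʳ₁ B a b) (idʳ₂ A a b))
          }
        ; comm = λ (a , b) (c , d) → ≡⇒∼ (comm₁ B a b c d) (comm₂ A a b c d)
        }
      ; distribʳ = λ (a , b) (c , d) (e , f) → ≡⇒∼ (distrib₁ B a b c d e f) (distrib₂ A a b c d e f)
      ; zeroˡ = λ (a , b) → ≡⇒∼ (zero₁ B a b) (zero₂ A a b)
      }
    }
    where
    ∼-isEquivalence : IsEquivalence _∼_
    ∼-isEquivalence = record
      { refl = ≡⇒∼ refl refl
      ; sym = λ (h , h′) → ≈-sym h , ≈-sym h′
      ; trans = λ (h , h′) (k , k′) → ≈-trans h k , ≈-trans h′ k′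
      }
    assoc₁ : ∀ A B a b c d e f →
      (a ℤ.* c ℤ.+ B ℤ.* (b ℤ.* d)) ℤ.* e ℤ.+ B ℤ.* ((a ℤ.* d ℤ.+ b ℤ.* c ℤ.+ A ℤ.* (b ℤ.* d)) ℤ.* f) ≡
      a ℤ.* (c ℤ.* e ℤ.+ B ℤ.* (d ℤ.* f)) ℤ.+ B ℤ.* (b ℤ.* (c ℤ.* f ℤ.+ d ℤ.* e ℤ.+ A ℤ.* (d ℤ.* f)))
    assoc₁ = solve-∀
    assoc₂ : ∀ A B a b c d e f →
      (a ℤ.* c ℤ.+ B ℤ.* (b ℤ.* d)) ℤ.* f ℤ.+ (a ℤ.* d ℤ.+ b ℤ.* c ℤ.+ A ℤ.* (b ℤ.* d)) ℤ.* e
        ℤ.+ A ℤ.* ((a ℤ.* d ℤ.+ b ℤ.* c ℤ.+ A ℤ.* (b ℤ.* d)) ℤ.* f) ≡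
      a ℤ.* (c ℤ.* f ℤ.+ d ℤ.* e ℤ.+ A ℤ.* (d ℤ.* f)) ℤ.+ b ℤ.* (c ℤ.* e ℤ.+ B ℤ.* (d ℤ.* f))
        ℤ.+ A ℤ.* (b ℤ.* (c ℤ.* f ℤ.+ d ℤ.* e ℤ.+ A ℤ.* (d ℤ.* f)))
    assoc₂ = solve-∀
    idˡ₁ : ∀ B a b → + 1 ℤ.* a ℤ.+ B ℤ.* (+ 0 ℤ.* b) ≡ a
    idˡ₁ = solve-∀
    idˡ₂ : ∀ A a b → + 1 ℤ.* b ℤ.+ + 0 ℤ.* a ℤ.+ A ℤ.* (+ 0 ℤ.* b) ≡ b
    idˡ₂ = solve-∀
    idʳ₁ : ∀ B a b → a ℤ.* + 1 ℤ.+ B ℤ.* (b ℤ.* + 0) ≡ a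
    idʳ₁ = solve-∀
    idʳ₂ : ∀ A a b → a ℤ.* + 0 ℤ.+ b ℤ.* + 1 ℤ.+ A ℤ.* (b ℤ.* + 0) ≡ b
    idʳ₂ = solve-∀
    comm₁ : ∀ B a b c d → a ℤ.* c ℤ.+ B ℤ.* (b ℤ.* d) ≡ c ℤ.* a ℤ.+ B ℤ.* (d ℤ.* b)
    comm₁ = solve-∀
    comm₂ : ∀ A a b c d → a ℤ.* d ℤ.+ b ℤ.* c ℤ.+ A ℤ.* (b ℤ.* d) ≡
                          c ℤ.* b ℤ.+ d ℤ.* a ℤ.+ A ℤ.* (d ℤ.* b)
    comm₂ = solve-∀
    distrib₁ : ∀ B a b c d e f →
      (c ℤ.+ e) ℤ.* a ℤ.+ B ℤ.* ((d ℤ.+ f) ℤ.* b) ≡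
      c ℤ.* a ℤ.+ B ℤ.* (d ℤ.* b) ℤ.+ (e ℤ.* a ℤ.+ B ℤ.* (f ℤ.* b))
    distrib₁ = solve-∀
    distrib₂ : ∀ A a b c d e f →
      (c ℤ.+ e) ℤ.* b ℤ.+ (d ℤ.+ f) ℤ.* a ℤ.+ A ℤ.* ((d ℤ.+ f) ℤ.* b) ≡
      c ℤ.* b ℤ.+ d ℤ.* a ℤ.+ A ℤ.* (d ℤ.* b) ℤ.+ (e ℤ.* b ℤ.+ f ℤ.* a ℤ.+ A ℤ.* (f ℤ.* b))
    distrib₂ = solve-∀
    zero₁ : ∀ B a b → + 0 ℤ.* a ℤ.+ B ℤ.* (+ 0 ℤ.* b) ≡ + 0
    zero₁ = solve-∀
    zero₂ : ∀ A a b → + 0 ℤ.* b ℤ.+ + 0 ℤ.* a ℤ.+ A ℤ.* (+ 0 ℤ.* b) ≡ + 0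
    zero₂ = solve-∀

  open CommutativeSemiring ring using (semiring)
  open import Algebra.Properties.CommutativeSemiring.Exp ring using (_^_) public
  open import Algebra.Properties.Semiring.Mult semiring using () renaming (_×_ to _·_)

  ·-componentwise : ∀ n a b → n · (a , b) ≡ (+ n ℤ.* a , + n ℤ.* b)
  ·-componentwise zero    a b = refl
  ·-componentwise (suc n) a b = trans (cong ((a , b) ⊕_) (·-componentwise n a b))
    (sym (cong₂ _,_ (ℤ.suc-* (+ n) a) (ℤ.suc-* (+ n) b)))

  char : ∀ x → m · x ∼ ι (+ 0)
  char (a , b) = subst (_∼ ι (+ 0)) (sym (·-componentwise m a b)) (multiple a , multiple b)
    where
    multiple : ∀ a → + m ℤ.* a ≈ + 0 [ m ]
    multiple a = mod (∣⇒≡0[mod] m (ℤ.∣m⇒∣m*n a ℤ.∣-refl))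

  ι-^ : ∀ a n → ι a ^ n ≡ ι (a ℤ.^ n)
  ι-^ a zero    = refl
  ι-^ a (suc n) = trans (cong (ι a ⊗_) (ι-^ a n))
    (cong₂ _,_ (real B a (a ℤ.^ n)) (imaginary A a (a ℤ.^ n)))
    where
    real : ∀ B a b → a ℤ.* b ℤ.+ B ℤ.* (+ 0 ℤ.* + 0) ≡ a ℤ.* b
    real = solve-∀
    imaginary : ∀ A a b → a ℤ.* + 0 ℤ.+ + 0 ℤ.* b ℤ.+ A ℤ.* (+ 0 ℤ.* + 0) ≡ + 0
    imaginary = solve-∀

  ι-cong : ∀ {a b} → a ≈ b [ m ] → ι a ∼ ι b
  ι-cong h = h , ≡⇒≈ refl

  -- Multiplication by α is one step of the recurrence. The constant coefficient equals B times the
  -- preceding term of E, written so as to make sense at n = 0 too. The equality is exact, before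
  -- reduction modulo m.
  α^n≡E : ∀ n → α ^ n ≡ (E A B (suc n) ℤ.- A ℤ.* E A B n , E A B n)
  α^n≡E zero    = cong (_, + 0) (unit A)
    where
    unit : ∀ A → + 1 ≡ + 1 ℤ.- A ℤ.* + 0
    unit = solve-∀
  α^n≡E (suc n) = trans (cong (α ⊗_) (α^n≡E n))
    (cong₂ _,_ (real A B (E A B (suc n)) (E A B n)) (imaginary A (E A B (suc n)) (E A B n)))
    where
    real : ∀ A B u v → + 0 ℤ.* (u ℤ.- A ℤ.* v) ℤ.+ B ℤ.* (+ 1 ℤ.* v) ≡ A ℤ.* u ℤ.+ B ℤ.* v ℤ.- A ℤ.* u
    real = solve-∀
    imaginary : ∀ A u v → + 0 ℤ.* v ℤ.+ + 1 ℤ.* (u ℤ.- A ℤ.* v) ℤ.+ A ℤ.* (+ 1 ℤ.* v) ≡ u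
    imaginary = solve-∀

  α^n∼1⇒E : ∀ n → α ^ n ∼ ι (+ 1) → E A B n ≡ + 0 [mod m ] × E A B (suc n) ≡ + 1 [mod m ]
  α^n∼1⇒E n h with subst (_∼ ι (+ 1)) (α^n≡E n) h
  ... | h₁ , h₀ = unmod h₀ , unmod (≈-trans (≡⇒≈ (expand A (E A B (suc n)) (E A B n)))
    (≈-trans (+-cong-≈ h₁ (*-cong-≈ (≡⇒≈ {a = A} refl) h₀)) (≡⇒≈ (unit A))))
    where
    expand : ∀ A u v → u ≡ u ℤ.- A ℤ.* v ℤ.+ A ℤ.* v
    expand = solve-∀
    unit : ∀ A → + 1 ℤ.+ A ℤ.* + 0 ≡ + 1
    unit = solve-∀

  E⇒α^n∼1 : ∀ n → E A B n ≡ + 0 [mod m ] × E A B (suc n) ≡ + 1 [mod m ] → α ^ n ∼ ι (+ 1)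
  E⇒α^n∼1 n (h₀ , h₁) = subst (_∼ ι (+ 1)) (sym (α^n≡E n))
    (≈-trans (≡⇒≈ (expand A (E A B (suc n)) (E A B n)))
      (≈-trans (+-cong-≈ E₁ (*-cong-≈ (≡⇒≈ {a = ℤ.- A} refl) E₀)) (≡⇒≈ (unit A)))
    , E₀)
    where
    E₀ : E A B n ≈ + 0 [ m ]
    E₀ = mod h₀
    E₁ : E A B (suc n) ≈ + 1 [ m ]
    E₁ = mod h₁
    expand : ∀ A u v → u ℤ.- A ℤ.* v ≡ u ℤ.+ ℤ.- A ℤ.* v
    expand = solve-∀
    unit : ∀ A → + 1 ℤ.+ ℤ.- A ℤ.* + 0 ≡ + 1
    unit = solve-∀

  -- Comparing coefficients in `α^n≡E` in both directions identifies the period of E with the order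
  -- of α.
  period∣ : ∀ {k} → IsPeriod m A B k → ∀ n → α ^ n ∼ ι (+ 1) → k ∣ n
  period∣ {k} (1≤k , Eₖ , least) = least-period∣ ring α
    (1≤k , E⇒α^n∼1 k Eₖ , λ j 1≤j h → least j 1≤j (α^n∼1⇒E j h))

-- Powers of α modulo an odd prime.

-- An odd prime exceeds 2, so it cannot divide the factor 2. This stands in for the division in α =
-- (A + δ)/2.
double-cancel : ∀ {p a b} → Prime p → ¬ (2 ∣ p) → a ℤ.+ a ≈ b ℤ.+ b [ p ] → a ≈ b [ p ]
double-cancel {p} {a} {b} pr 2∤p (mod h) = mod
  ([ (λ p∣2 → contradiction (∣⇒≤ (ℤ.∣⇒∣ᵤ p∣2)) (p≰2 p pr 2∤p)) , id ]′
    (euclidℤ pr (+ 2) (a ℤ.- b) (subst (+ p ℤ.∣_) (factor a b) h)))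
  where
  factor : ∀ a b → a ℤ.+ a ℤ.- (b ℤ.+ b) ≡ + 2 ℤ.* (a ℤ.- b)
  factor = solve-∀
  p≰2 : ∀ p → Prime p → ¬ (2 ∣ p) → ¬ (p ≤ 2)
  p≰2 0 pr 2∤p _ = ¬prime[0] pr
  p≰2 1 pr 2∤p _ = ¬prime[1] pr
  p≰2 2 pr 2∤p _ = 2∤p ∣-refl
  p≰2 (suc (suc (suc _))) pr 2∤p (s≤s (s≤s ()))

module _ {p} (pr : Prime p) (2∤p : ¬ (2 ∣ p)) (A B : ℤ)
         (nonres : QuadraticNonresidue p (A ℤ.^ 2 ℤ.+ + 4 ℤ.* B)) where

  open QuadraticExtension p A B
  open CommutativeSemiring ring using (setoid; +-cong; +-congˡ; *-congˡ)
  open import Algebra.Properties.CommutativeSemiring.Exp ring using (^-assocʳ; ^-congˡ; ^-congʳ)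
  open import Relation.Binary.Reasoning.Setoid setoid

  private
    h = p / 2
    Δ = A ℤ.^ 2 ℤ.+ + 4 ℤ.* B

    δ : ℤ × ℤ
    δ = ℤ.- A , + 2

  -- (2α - A)² = 4(α² - Aα) + A² = 4B + A², already over the integers.
  δ²≡Δ : δ ^ 2 ≡ ι Δ
  δ²≡Δ = cong₂ _,_ (real A B) (imaginary A B)
    where
    real : ∀ A B → ℤ.- A ℤ.* (ℤ.- A ℤ.* + 1 ℤ.+ B ℤ.* (+ 2 ℤ.* + 0))
                     ℤ.+ B ℤ.* (+ 2 ℤ.* (ℤ.- A ℤ.* + 0 ℤ.+ + 2 ℤ.* + 1 ℤ.+ A ℤ.* (+ 2 ℤ.* + 0))) ≡
                   A ℤ.* (A ℤ.* + 1) ℤ.+ + 4 ℤ.* B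
    real = solve-∀
    imaginary : ∀ A B → ℤ.- A ℤ.* (ℤ.- A ℤ.* + 0 ℤ.+ + 2 ℤ.* + 1 ℤ.+ A ℤ.* (+ 2 ℤ.* + 0))
                          ℤ.+ + 2 ℤ.* (ℤ.- A ℤ.* + 1 ℤ.+ B ℤ.* (+ 2 ℤ.* + 0))
                          ℤ.+ A ℤ.* (+ 2 ℤ.* (ℤ.- A ℤ.* + 0 ℤ.+ + 2 ℤ.* + 1 ℤ.+ A ℤ.* (+ 2 ℤ.* + 0))) ≡ + 0
    imaginary = solve-∀

  -- Writing p = 1 + 2h turns the power into δ Δ^h. The sign is a factor `ι (- 1)` because the ring
  -- is packaged as a semiring.
  δ^p∼-δ : δ ^ p ∼ δ ⊗ ι (ℤ.- + 1)
  δ^p∼-δ = begin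
    δ ^ p                ≡⟨ cong (δ ^_) (odd⇒≡1+2* p 2∤p) ⟩
    δ ⊗ δ ^ (2 * h)      ≈⟨ *-congˡ {δ} (^-assocʳ δ 2 h) ⟨
    δ ⊗ (δ ^ 2) ^ h      ≡⟨ cong (λ x → δ ⊗ x ^ h) δ²≡Δ ⟩
    δ ⊗ ι Δ ^ h          ≡⟨ cong (δ ⊗_) (ι-^ Δ h) ⟩
    δ ⊗ ι (Δ ℤ.^ h)      ≈⟨ *-congˡ {δ} (ι-cong Δʰ≈-1) ⟩
    δ ⊗ ι (ℤ.- + 1)      ∎
    where
    Δʰ≈-1 : Δ ℤ.^ h ≈ ℤ.- + 1 [ p ]
    Δʰ≈-1 = mod (euler-criterion {h = h} pr (odd⇒≡1+2* p 2∤p) Δ nonres)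

  -- Frobenius sends α to its conjugate A - α. It is applied to both sides of α + α = A + δ, the
  -- left side giving 2α^p directly, and then 2 is cancelled in each coordinate.
  α^p∼A-α : α ^ p ∼ (A , ℤ.- + 1)
  α^p∼A-α = double-cancel pr 2∤p (re doubled) , double-cancel pr 2∤p (im doubled)
    where
    2α : α ⊕ α ≡ ι A ⊕ δ
    2α = cong (_, + 2) (sym (ℤ.+-inverseʳ A))
    real : ∀ A B → A ℤ.+ (ℤ.- A ℤ.* ℤ.- + 1 ℤ.+ B ℤ.* (+ 2 ℤ.* + 0)) ≡ A ℤ.+ A
    real = solve-∀
    imaginary : ∀ A → + 0 ℤ.+ (ℤ.- A ℤ.* + 0 ℤ.+ + 2 ℤ.* ℤ.- + 1 ℤ.+ A ℤ.* (+ 2 ℤ.* + 0)) ≡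
                      ℤ.- + 1 ℤ.+ ℤ.- + 1
    imaginary = solve-∀
    doubled : α ^ p ⊕ α ^ p ∼ (A , ℤ.- + 1) ⊕ (A , ℤ.- + 1)
    doubled = begin
      α ^ p ⊕ α ^ p                    ≈⟨ frobenius ring pr char α α ⟨
      (α ⊕ α) ^ p                      ≡⟨ cong (_^ p) 2α ⟩
      (ι A ⊕ δ) ^ p                    ≈⟨ frobenius ring pr char (ι A) δ ⟩
      ι A ^ p ⊕ δ ^ p                  ≡⟨ cong (_⊕ δ ^ p) (ι-^ A p) ⟩
      ι (A ℤ.^ p) ⊕ δ ^ p              ≈⟨ +-cong (ι-cong (mod {A ℤ.^ p} {A} (fermat pr A))) δ^p∼-δ ⟩
      ι A ⊕ δ ⊗ ι (ℤ.- + 1)            ≡⟨ cong₂ _,_ (real A B) (imaginary A) ⟩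
      (A , ℤ.- + 1) ⊕ (A , ℤ.- + 1)    ∎

  -- The product of α with its conjugate is its norm, Aα - α² = -B.
  α^[p+1]∼-B : α ^ (p + 1) ∼ ι (ℤ.- B)
  α^[p+1]∼-B = begin
    α ^ (p + 1)          ≡⟨ cong (α ^_) (ℕ.+-comm p 1) ⟩
    α ⊗ α ^ p            ≈⟨ *-congˡ {α} α^p∼A-α ⟩
    α ⊗ (A , ℤ.- + 1)    ≡⟨ cong₂ _,_ (real A B) (imaginary A) ⟩
    ι (ℤ.- B)            ∎
    where
    real : ∀ A B → + 0 ℤ.* A ℤ.+ B ℤ.* (+ 1 ℤ.* ℤ.- + 1) ≡ ℤ.- B
    real = solve-∀
    imaginary : ∀ A → + 0 ℤ.* ℤ.- + 1 ℤ.+ + 1 ℤ.* A ℤ.+ A ℤ.* (+ 1 ℤ.* ℤ.- + 1) ≡ + 0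
    imaginary = solve-∀

  -- The factor 2 in the exponent squares -B, which removes the sign and leaves the power of B² that
  -- is 1 by hypothesis.
  α^[2[p+1]o]∼1 : ∀ o → (B ℤ.^ 2) ℤ.^ o ≡ + 1 [mod p ] → α ^ (2 * (p + 1) * o) ∼ ι (+ 1)
  α^[2[p+1]o]∼1 o B²ᵒ≡1 = begin
    α ^ (2 * (p + 1) * o)          ≡⟨ cong (λ n → α ^ (n * o)) (ℕ.*-comm 2 (p + 1)) ⟩
    α ^ ((p + 1) * 2 * o)          ≈⟨ ^-assocʳ α ((p + 1) * 2) o ⟨
    (α ^ ((p + 1) * 2)) ^ o        ≈⟨ ^-congˡ o (^-assocʳ α (p + 1) 2) ⟨
    ((α ^ (p + 1)) ^ 2) ^ o        ≈⟨ ^-congˡ o (^-congˡ 2 α^[p+1]∼-B) ⟩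
    (ι (ℤ.- B) ^ 2) ^ o            ≡⟨ cong (_^ o) (ι-^ (ℤ.- B) 2) ⟩
    ι ((ℤ.- B) ℤ.^ 2) ^ o          ≡⟨ cong (λ b → ι b ^ o) (even B) ⟩
    ι (B ℤ.^ 2) ^ o                ≡⟨ ι-^ (B ℤ.^ 2) o ⟩
    ι ((B ℤ.^ 2) ℤ.^ o)            ≈⟨ ι-cong (mod B²ᵒ≡1) ⟩
    ι (+ 1)                        ∎
    where
    even : ∀ B → ℤ.- B ℤ.* (ℤ.- B ℤ.* + 1) ≡ B ℤ.* (B ℤ.* + 1)
    even = solve-∀

theorem9 :
    (p : ℕ) (pr : Prime p) → ¬ (2 ∣ p) → (A B : ℤ) →
    (nonres : QuadraticNonresidue p (A ℤ.^ 2 ℤ.+ + 4 ℤ.* B)) →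
    let p∤B = nonresidue⇒∤B A B nonres
        k   = period pr A B p∤B
        o   = ord pr (B ℤ.^ 2) (∤⇒coprime-square pr B p∤B)
    in (k ∣ 2 * (p + 1) * o) × (k ≤ 2 * (p + 1) * o)
theorem9 p pr 2∤p A B nonres = k∣N , ∣⇒≤ {{>-nonZero 0<N}} k∣N
  where
  p∤B = nonresidue⇒∤B A B nonres
  isPeriod = proj₂ (period-exists pr A B p∤B)
  isOrder = proj₂ (ord-exists p {{prime⇒nonZero pr}} (B ℤ.^ 2) (∤⇒coprime-square pr B p∤B))
  o = ord pr (B ℤ.^ 2) (∤⇒coprime-square pr B p∤B)

  k∣N : period pr A B p∤B ∣ 2 * (p + 1) * o
  k∣N = QuadraticExtension.period∣ p A B isPeriod _
    (α^[2[p+1]o]∼1 pr 2∤p A B nonres o (proj₁ (proj₂ isOrder)))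

  -- A divisor is bounded by a multiple only if the multiple is positive; the order is positive by
  -- its definition.
  0<N : 0 < 2 * (p + 1) * o
  0<N = ℕ.*-mono-≤ {1} {2 * (p + 1)} {1} {o}
    (ℕ.≤-trans (ℕ.m≤n+m 1 p) (ℕ.m≤m+n (p + 1) (p + 1 + 0))) (proj₁ isOrder)
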